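{- Let $X_1,\ldots,X_n$ be pairwise disjoint nonempty finite sets, $X=\bigcup_{i=1}^n X_i$, and let $f:2^X\to\mathbb{R}_{\ge 0}$ be normalized, monotone and submodular. Let $(x_1^*,\ldots,x_n^*)$, with $x_i^*\in X_i$ for each $i$, be an optimal solution, i.e. a maximizer of $f(x_1,\ldots,x_n)$ over all choices $x_i\in X_i$. Let $\kappa\ge 1$ be an integer and let the agents $\{1,\ldots,n\}$ be partitioned into $\kappa$ cliques $$\{1,\ldots,m_1\},\ \{m_1+1,\ldots,m_2\},\ \ldots,\ \{m_{\kappa-1}+1,\ldots,n\},$$ where $1\le m_1<m_2<\cdots<m_{\kappa-1}<n$. Suppose each agent observes the choices of all preceding agents in its own clique, and that, for $i\in\{1,\ldots,\kappa-1\}$, the only information from other cliques available to the agents in the $(i+1)$-st clique is the choice of agent $m_i$ (which every agent of the $(i+1)$-st clique observes); agents in the first clique have no information from other cliques. Let $X_{\mathrm{in}}(j)$ denote the set of choices observed by agent $j$, and suppose $x_1,\ldots,x_n$ are chosen sequentially so that $x_j\in\operatorname{argmax}_{x\in X_j}\Delta(x\mid X_{\mathrm{in}}(j))$ for each $j\in\{1,\ldots,n\}$, with ties broken arbitrarily. Then $$f(x_1,\ldots,x_n)\ \ge\ \frac{1}{2\kappa}\Big(f(x_1^*,\ldots,x_n^*)+\sum_{i=1}^{\kappa-1} f(x_{m_i}^*)\Big).$$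
   Context: A function $f:2^X\to\mathbb{R}_{\ge0}$ is submodular if $f(A\cup\{x\})-f(A)\ge f(B\cup\{x\})-f(B)$ for all $A\subseteq B\subseteq X$ and $x\in X\setminus B$; monotone if $f(A)\le f(B)$ whenever $A\subseteq B\subseteq X$; normalized if $f(\emptyset)=0$. The marginal reward of $x$ given $A$ is $\Delta(x\mid A)=f(A\cup\{x\})-f(A)$. The notation $f(y_1,\ldots,y_k)$ means $f(\{y_1,\ldots,y_k\})$. Explicitly, with $m_0=0$ and $m_\kappa=n$, an agent $j$ with $m_{i}<j\le m_{i+1}$ observes $X_{\mathrm{in}}(j)=\{x_l : m_i\le l<j\}$ if $i\ge1$, and $X_{\mathrm{in}}(j)=\{x_l:1\le l<j\}$ if $i=0$. For $\kappa=1$ there is a single clique $\{1,\ldots,n\}$ and the sum is empty. -}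

module Defs where

open import Data.Fin.Base using (Fin; toℕ; fromℕ<)
open import Data.Fin.Properties using (toℕ<n; toℕ-fromℕ<)
open import Data.Fin.Subset using (Subset; ⊥; ⁅_⁆; _∈_; _∉_; _⊆_; _∪_; _∩_; ⋃; Nonempty; Empty)
open import Data.Integer.Base using (+_)
open import Data.List.Base using (allFin; filter; map; tabulate)
open import Data.Nat.Base as ℕ using (ℕ; zero; suc; pred; NonZero; _⊔_)
import Data.Nat.Properties as ℕ
open import Data.Product using (∃-syntax; _×_; _,_)
open import Data.Rational as ℚ using (ℚ; 0ℚ; 1ℚ; ½; Positive; positive; ∣_∣)
import Data.Rational.Properties as ℚ
open import Data.Rational.Solver using (module +-*-Solver)
open import Data.Vec.Functional using (foldr)
open import Function.Base using (_∘_)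
open import Relation.Binary.PropositionalEquality
open import Relation.Nullary.Decidable using (_×-dec_)
open import Relation.Unary using (Pred; Decidable)

-- A real number is a Cauchy sequence of rationals; two sequences denote the
-- same real when _≃ℝ_ relates them.

Cauchy : (ℕ → ℚ) → Set
Cauchy s = ∀ ε → 0ℚ ℚ.< ε →
  ∃[ M ] (∀ i j → M ℕ.≤ i → M ℕ.≤ j → ∣ s i ℚ.- s j ∣ ℚ.< ε)

record ℝ : Set where
  constructor mkℝ
  field
    seq    : ℕ → ℚ
    cauchy : Cauchy seq

open ℝ public

infix  4 _≤ℝ_ _≃ℝ_
infixl 6 _+ℝ_ _-ℝ_
infixr 7 _·ℝ_
infix  8 -ℝ_

_≤ℝ_ : ℝ → ℝ → Set
x ≤ℝ y = ∀ ε → 0ℚ ℚ.< ε →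
  ∃[ M ] (∀ i → M ℕ.≤ i → seq x i ℚ.≤ seq y i ℚ.+ ε)

_≃ℝ_ : ℝ → ℝ → Set
x ≃ℝ y = (x ≤ℝ y) × (y ≤ℝ x)

private
  halve : ∀ ε → ε ℚ.* ½ ℚ.+ ε ℚ.* ½ ≡ ε
  halve ε = trans (sym (ℚ.*-distribˡ-+ ε ½ ½)) (ℚ.*-identityʳ ε)

  half-pos : ∀ {ε} → 0ℚ ℚ.< ε → 0ℚ ℚ.< ε ℚ.* ½
  half-pos 0<ε = ℚ.*-monoˡ-<-pos ½ 0<ε

  interchange : ∀ a b c d →
    (a ℚ.+ b) ℚ.- (c ℚ.+ d) ≡ (a ℚ.- c) ℚ.+ (b ℚ.- d)
  interchange = solve 4
    (λ a b c d → (a :+ b) :- (c :+ d) := (a :- c) :+ (b :- d)) refl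
    where open +-*-Solver

  factor : ∀ q a b → q ℚ.* a ℚ.- q ℚ.* b ≡ q ℚ.* (a ℚ.- b)
  factor = solve 3 (λ q a b → q :* a :- q :* b := q :* (a :- b)) refl
    where open +-*-Solver

  const-cauchy : ∀ q → Cauchy (λ _ → q)
  const-cauchy q ε 0<ε = 0 , λ _ _ _ _ →
    subst (λ d → ∣ d ∣ ℚ.< ε) (sym (ℚ.+-inverseʳ q)) 0<ε

  +-cauchy : ∀ s t → Cauchy s → Cauchy t → Cauchy (λ i → s i ℚ.+ t i)
  +-cauchy s t cs ct ε 0<ε
    with M , p ← cs (ε ℚ.* ½) (half-pos 0<ε)
       | N , q ← ct (ε ℚ.* ½) (half-pos 0<ε)
    = M ⊔ N , λ i j Mi Mj → begin-strict
      ∣ (s i ℚ.+ t i) ℚ.- (s j ℚ.+ t j) ∣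
        ≡⟨ cong ∣_∣ (interchange (s i) (t i) (s j) (t j)) ⟩
      ∣ (s i ℚ.- s j) ℚ.+ (t i ℚ.- t j) ∣
        ≤⟨ ℚ.∣p+q∣≤∣p∣+∣q∣ (s i ℚ.- s j) (t i ℚ.- t j) ⟩
      ∣ s i ℚ.- s j ∣ ℚ.+ ∣ t i ℚ.- t j ∣
        <⟨ ℚ.+-mono-<
             (p i j (ℕ.m⊔n≤o⇒m≤o M N Mi) (ℕ.m⊔n≤o⇒m≤o M N Mj))
             (q i j (ℕ.m⊔n≤o⇒n≤o M N Mi) (ℕ.m⊔n≤o⇒n≤o M N Mj)) ⟩
      ε ℚ.* ½ ℚ.+ ε ℚ.* ½
        ≡⟨ halve ε ⟩
      ε ∎
    where open ℚ.≤-Reasoning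

  ·-cauchy : ∀ q s → Cauchy s → Cauchy (λ i → q ℚ.* s i)
  ·-cauchy q s cs ε 0<ε = bound (cs δ (ℚ.positive⁻¹ δ))
    where
    open ℚ.≤-Reasoning
    instance
      c⁺ : Positive (∣ q ∣ ℚ.+ 1ℚ)
      c⁺ = ℚ.nonNeg+pos⇒pos ∣ q ∣ {{ℚ.∣-∣-nonNeg q}} 1ℚ
    c : ℚ
    c = ∣ q ∣ ℚ.+ 1ℚ
    instance
      c≢0 : ℚ.NonZero c
      c≢0 = ℚ.pos⇒nonZero c
      1/c⁺ : Positive (ℚ.1/ c)
      1/c⁺ = ℚ.1/pos⇒pos c
      ε⁺ : Positive ε
      ε⁺ = positive 0<ε
      ∣q∣⁺ : ℚ.NonNegative ∣ q ∣
      ∣q∣⁺ = ℚ.∣-∣-nonNeg q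
    δ : ℚ
    δ = ℚ.1/ c ℚ.* ε
    instance
      δ⁺ : Positive δ
      δ⁺ = ℚ.pos*pos⇒pos (ℚ.1/ c) ε
    ∣q∣<c : ∣ q ∣ ℚ.< c
    ∣q∣<c = subst (ℚ._< c) (ℚ.+-identityʳ ∣ q ∣)
              (ℚ.+-monoʳ-< ∣ q ∣ (ℚ.positive⁻¹ 1ℚ))
    bound : ∃[ M ] (∀ i j → M ℕ.≤ i → M ℕ.≤ j → ∣ s i ℚ.- s j ∣ ℚ.< δ) →
            ∃[ M ] (∀ i j → M ℕ.≤ i → M ℕ.≤ j →
                    ∣ q ℚ.* s i ℚ.- q ℚ.* s j ∣ ℚ.< ε)
    bound (M , p) = M , λ i j Mi Mj → begin-strict
      ∣ q ℚ.* s i ℚ.- q ℚ.* s j ∣  ≡⟨ cong ∣_∣ (factor q (s i) (s j)) ⟩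
      ∣ q ℚ.* (s i ℚ.- s j) ∣      ≡⟨ ℚ.∣p*q∣≡∣p∣*∣q∣ q (s i ℚ.- s j) ⟩
      ∣ q ∣ ℚ.* ∣ s i ℚ.- s j ∣    ≤⟨ ℚ.*-monoˡ-≤-nonNeg ∣ q ∣ (ℚ.<⇒≤ (p i j Mi Mj)) ⟩
      ∣ q ∣ ℚ.* δ                  <⟨ ℚ.*-monoˡ-<-pos δ ∣q∣<c ⟩
      c ℚ.* (ℚ.1/ c ℚ.* ε)         ≡⟨ sym (ℚ.*-assoc c (ℚ.1/ c) ε) ⟩
      c ℚ.* ℚ.1/ c ℚ.* ε           ≡⟨ cong (ℚ._* ε) (ℚ.*-inverseʳ c) ⟩
      1ℚ ℚ.* ε                     ≡⟨ ℚ.*-identityˡ ε ⟩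
      ε                            ∎

0ℝ : ℝ
0ℝ = mkℝ (λ _ → 0ℚ) (const-cauchy 0ℚ)

_+ℝ_ : ℝ → ℝ → ℝ
x +ℝ y = mkℝ (λ i → seq x i ℚ.+ seq y i) (+-cauchy (seq x) (seq y) (cauchy x) (cauchy y))

_·ℝ_ : ℚ → ℝ → ℝ
q ·ℝ x = mkℝ (λ i → q ℚ.* seq x i) (·-cauchy q (seq x) (cauchy x))

-ℝ_ : ℝ → ℝ
-ℝ x = (ℚ.- 1ℚ) ·ℝ x

_-ℝ_ : ℝ → ℝ → ℝ
x -ℝ y = x +ℝ (-ℝ y)

∑ℝ : ∀ {k} → (Fin k → ℝ) → ℝ
∑ℝ = foldr _+ℝ_ 0ℝ

SetFunction : ℕ → Set
SetFunction N = Subset N → ℝ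

module _ {N : ℕ} (f : SetFunction N) where

  NonNegative : Set
  NonNegative = ∀ A → 0ℝ ≤ℝ f A

  Normalized : Set
  Normalized = f ⊥ ≃ℝ 0ℝ

  Monotone : Set
  Monotone = ∀ A B → A ⊆ B → f A ≤ℝ f B

  Δ : Fin N → Subset N → ℝ
  Δ x A = f (A ∪ ⁅ x ⁆) -ℝ f A

  Submodular : Set
  Submodular = ∀ A B x → A ⊆ B → x ∉ B → Δ x B ≤ℝ Δ x A

-- Agents are elements of Fin n but are numbered from 1.
agentNo : ∀ {n} → Fin n → ℕ
agentNo j = suc (toℕ j)

IsArgmax : ∀ {N} → (Fin N → ℝ) → Subset N → Fin N → Set
IsArgmax g S x = (x ∈ S) × (∀ y → y ∈ S → g y ≤ℝ g x)

module _ {N n : ℕ} where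

  record IsPartition (X : Fin n → Subset N) : Set where
    field
      nonempty : ∀ i → Nonempty (X i)
      disjoint : ∀ i j → i ≢ j → Empty (X i ∩ X j)
      covers   : ∀ x → ∃[ i ] x ∈ X i

  -- { y l ∣ l satisfies P }
  choicesOf : (y : Fin n → Fin N) → ∀ {p} {P : Pred (Fin n) p} → Decidable P → Subset N
  choicesOf y P? = ⋃ (map (⁅_⁆ ∘ y) (filter P? (allFin n)))

  -- { y₁ , … , yₙ }
  choices : (Fin n → Fin N) → Subset N
  choices y = ⋃ (tabulate (⁅_⁆ ∘ y))

  Feasible : (Fin n → Subset N) → (Fin n → Fin N) → Set
  Feasible X y = ∀ i → y i ∈ X i

  IsOptimal : SetFunction N → (Fin n → Subset N) → (Fin n → Fin N) → Set
  IsOptimal f X x* =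
    Feasible X x* × (∀ y → Feasible X y → f (choices y) ≤ℝ f (choices x*))

-- Partition of the agents into κ consecutive cliques, clique i + 1 being
-- { mᵢ + 1 , … , mᵢ₊₁ } for i < κ.  Values m i with i > κ are irrelevant.
record Cliques (n κ : ℕ) : Set where
  field
    m       : ℕ → ℕ
    m-first : m 0 ≡ 0
    m-last  : m κ ≡ n
    m-mono  : ∀ i → i ℕ.< κ → m i ℕ.< m (suc i)

  m≤m : ∀ i d → i ℕ.+ d ℕ.≤ κ → m i ℕ.≤ m (i ℕ.+ d)
  m≤m i zero    _ = ℕ.≤-reflexive (cong m (sym (ℕ.+-identityʳ i)))
  m≤m i (suc d) h = begin
    m i               ≤⟨ m≤m i d (ℕ.<⇒≤ i+d<κ) ⟩
    m (i ℕ.+ d)       ≤⟨ ℕ.<⇒≤ (m-mono (i ℕ.+ d) i+d<κ) ⟩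
    m (suc (i ℕ.+ d)) ≡⟨ cong m (sym (ℕ.+-suc i d)) ⟩
    m (i ℕ.+ suc d)   ∎
    where
    open ℕ.≤-Reasoning
    i+d<κ : i ℕ.+ d ℕ.< κ
    i+d<κ = subst (ℕ._≤ κ) (ℕ.+-suc i d) h

  m≤n : ∀ i → i ℕ.≤ κ → m i ℕ.≤ n
  m≤n i i≤κ = begin
    m i                 ≤⟨ m≤m i (κ ℕ.∸ i) (ℕ.≤-reflexive (ℕ.m+[n∸m]≡n i≤κ)) ⟩
    m (i ℕ.+ (κ ℕ.∸ i)) ≡⟨ cong m (ℕ.m+[n∸m]≡n i≤κ) ⟩
    m κ                 ≡⟨ m-last ⟩
    n                   ∎
    where open ℕ.≤-Reasoning

  suc-i<κ : (i : Fin (pred κ)) → suc (toℕ i) ℕ.< κ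
  suc-i<κ i = ℕ.<-≤-trans (ℕ.s<s (toℕ<n i)) (suc-pred≤ κ (toℕ<n i))
    where
    suc-pred≤ : ∀ k {i} → i ℕ.< pred k → suc (pred k) ℕ.≤ k
    suc-pred≤ (suc k) _ = ℕ.≤-refl

  m-pos : ∀ i → i ℕ.< κ → 0 ℕ.< m (suc i)
  m-pos i i<κ = ℕ.≤-<-trans ℕ.z≤n (m-mono i i<κ)

  pred-m<n : ∀ i → i ℕ.< κ → pred (m (suc i)) ℕ.< n
  pred-m<n i i<κ = ℕ.<-≤-trans
    (ℕ.≤-reflexive (ℕ.suc-pred (m (suc i)) {{ℕ.>-nonZero (m-pos i i<κ)}}))
    (m≤n (suc i) i<κ)

  -- The agents m₁, …, m_{κ-1} (see agentNo-boundary); i : Fin (κ - 1) gives m_{i+1}.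
  boundary : Fin (pred κ) → Fin n
  boundary i = fromℕ< (pred-m<n (toℕ i) (ℕ.<⇒≤ (suc-i<κ i)))

  agentNo-boundary : ∀ i → agentNo (boundary i) ≡ m (suc (toℕ i))
  agentNo-boundary i = trans
    (cong suc (toℕ-fromℕ< (pred-m<n (toℕ i) (ℕ.<⇒≤ (suc-i<κ i)))))
    (ℕ.suc-pred (m (suc (toℕ i)))
      {{ℕ.>-nonZero (m-pos (toℕ i) (ℕ.<⇒≤ (suc-i<κ i)))}})

  InClique : ℕ → Fin n → Set
  InClique i j = (m i ℕ.< agentNo j) × (agentNo j ℕ.≤ m (suc i))

  -- X_in(j) = { x_l ∣ mᵢ ≤ l < j } for an agent j of clique i + 1.  For i = 0 the
  -- lower bound m₀ = 0 is vacuous, because agent numbers start at 1.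
  observed : ∀ {N} → (Fin n → Fin N) → ℕ → Fin n → Subset N
  observed x i j = choicesOf x
    (λ l → (m i ℕ.≤? agentNo l) ×-dec (agentNo l ℕ.<? agentNo j))

  IsGreedy : ∀ {N} → SetFunction N → (Fin n → Subset N) → (Fin n → Fin N) → Set
  IsGreedy f X x = ∀ i j → i ℕ.< κ → InClique i j →
    IsArgmax (λ y → Δ f y (observed x i j)) (X j) (x j)

1/[2*_] : (κ : ℕ) .{{_ : NonZero κ}} → ℚ
1/[2* κ ] = ((+ 1) ℚ./ (2 ℕ.* κ)) {{ℕ.m*n≢0 2 κ}}

{-# OPTIONS --safe #-}

-- Write m₀ = 0 and, for an agent j of clique i + 1, E(j) for the observed set
-- X_in(j).  Adding the optimal choices one agent at a time to {x₁, …, xₙ}, the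
-- agents of clique i + 1 contribute at most f(x_{mᵢ}, …, x_{mᵢ₊₁}) ≤ f(x₁, …, xₙ):
-- by submodularity and the greedy rule
-- Δ(x*_j ∣ …) ≤ Δ(x*_j ∣ E(j)) ≤ Δ(x_j ∣ E(j)), and the last terms telescope
-- along the clique.  Hence f(x*₁, …, x*ₙ) ≤ (κ + 1) f(x₁, …, xₙ).  The greedy rule
-- also gives f(x*_j) ≤ f(E(j) ∪ {x*_j}) ≤ f(E(j) ∪ {x_j}) ≤ f(x₁, …, xₙ), so the
-- κ - 1 boundary terms add at most (κ - 1) f(x₁, …, xₙ), for a total of
-- 2κ f(x₁, …, xₙ).

module Submission where

open import Defs
open import Data.Nat.Base using (ℕ; NonZero)
open import Data.Fin.Base using (Fin)
open import Data.Fin.Subset using (Subset; ⁅_⁆)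

open import Data.Empty using (⊥-elim)
open import Data.Fin.Base using (zero; suc; toℕ; fromℕ<)
open import Data.Fin.Properties using (toℕ<n; toℕ-fromℕ<; toℕ-injective)
open import Data.Fin.Subset using (_∈_; _⊆_; _∪_; ⋃)
open import Data.Fin.Subset.Properties
  using (_∈?_; ∉⊥; x∈⁅x⁆; x∈⁅y⁆⇒x≡y; p⊆p∪q; q⊆p∪q; x∈p∪q⁻; ⊆-refl; ⊆-trans)
open import Data.Integer.Base as ℤ using (+_)
import Data.Integer.Properties as ℤ
open import Data.List.Base using (List; []; _∷_; allFin)
open import Data.List.Membership.Propositional using () renaming (_∈_ to _∈ˡ_)
open import Data.List.Membership.Propositional.Properties
  using (∈-map⁺; ∈-map⁻; ∈-filter⁺; ∈-filter⁻; ∈-tabulate⁺; ∈-tabulate⁻; ∈-allFin)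
open import Data.List.Relation.Unary.Any using (here; there)
open import Data.Nat.Base as ℕ using (zero; suc; pred; _⊔_; _≤′_; ≤′-reflexive; ≤′-step)
import Data.Nat.Properties as ℕ
open import Data.Product using (∃-syntax; _×_; _,_; proj₁; proj₂)
open import Data.Rational as ℚ using (ℚ; 0ℚ; 1ℚ; ½; Positive; positive)
import Data.Rational.Properties as ℚ
open import Data.Rational.Solver using (module +-*-Solver)
open import Data.Rational.Unnormalised as ℚᵘ using (mkℚᵘ; *≡*)
import Data.Rational.Unnormalised.Properties as ℚᵘ
open import Data.Sum using (_⊎_; inj₁; inj₂; [_,_]′)
open import Function.Base using (_∘_)
import Relation.Binary.Reasoning.Base.Single as SingleReasoning
open import Relation.Binary.PropositionalEquality
open import Relation.Nullary using (yes; no)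
open import Relation.Nullary.Decidable using (_×-dec_)
open import Relation.Unary using (Pred; Decidable)

-- The ordered vector space ℝ

≤ℝ-refl : ∀ {x} → x ≤ℝ x
≤ℝ-refl {x} ε 0<ε = 0 , λ i _ →
  subst (ℚ._≤ seq x i ℚ.+ ε) (ℚ.+-identityʳ (seq x i))
    (ℚ.+-monoʳ-≤ (seq x i) (ℚ.<⇒≤ 0<ε))

≤ℝ-trans : ∀ {x y z} → x ≤ℝ y → y ≤ℝ z → x ≤ℝ z
≤ℝ-trans {x} {y} {z} x≤y y≤z ε 0<ε
  with M , p ← x≤y (ε ℚ.* ½) (ℚ.*-monoˡ-<-pos ½ 0<ε)
     | L , q ← y≤z (ε ℚ.* ½) (ℚ.*-monoˡ-<-pos ½ 0<ε)
  = M ⊔ L , λ i ML≤i → begin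
    seq x i                            ≤⟨ p i (ℕ.m⊔n≤o⇒m≤o M L ML≤i) ⟩
    seq y i ℚ.+ ε ℚ.* ½                ≤⟨ ℚ.+-monoˡ-≤ (ε ℚ.* ½) (q i (ℕ.m⊔n≤o⇒n≤o M L ML≤i)) ⟩
    seq z i ℚ.+ ε ℚ.* ½ ℚ.+ ε ℚ.* ½    ≡⟨ halves (seq z i) ε ⟩
    seq z i ℚ.+ ε                      ∎
  where
  open ℚ.≤-Reasoning
  halves : ∀ a e → a ℚ.+ e ℚ.* ½ ℚ.+ e ℚ.* ½ ≡ a ℚ.+ e
  halves = solve 2 (λ a e → a :+ e :* con ½ :+ e :* con ½ := a :+ e) refl
    where open +-*-Solver

-- A chain with one preorder suffices: equal reals are only `≃ℝ`-related in general, so an algebraic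
-- rearrangement enters a chain as one more inequality.
module ≤ℝ-Reasoning = SingleReasoning _≤ℝ_ (λ {x} → ≤ℝ-refl {x}) (λ {x y z} → ≤ℝ-trans {x} {y} {z})

≗⇒≤ℝ : ∀ x y → (∀ i → seq x i ≡ seq y i) → x ≤ℝ y
≗⇒≤ℝ x y x≗y ε 0<ε with M , p ← ≤ℝ-refl {x} ε 0<ε =
  M , λ i M≤i → subst (λ a → seq x i ℚ.≤ a ℚ.+ ε) (x≗y i) (p i M≤i)

-- The order sees only the termwise difference of the two sequences: adding `seq z i - seq x i` to
-- both sides of the given bound keeps the same `M` and `ε`. Monotonicity, cancellation and
-- transposition of sums thereby become ring identities.
≤ℝ-resp-difference : ∀ x y z w →
  (∀ i → seq y i ℚ.- seq x i ≡ seq w i ℚ.- seq z i) → x ≤ℝ y → z ≤ℝ w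
≤ℝ-resp-difference x y z w same x≤y ε 0<ε with M , p ← x≤y ε 0<ε =
  M , λ i M≤i → begin
    seq z i                                          ≡⟨ insert (seq z i) (seq x i) ⟩
    seq z i ℚ.- seq x i ℚ.+ seq x i                  ≤⟨ ℚ.+-monoʳ-≤ (seq z i ℚ.- seq x i) (p i M≤i) ⟩
    seq z i ℚ.- seq x i ℚ.+ (seq y i ℚ.+ ε)          ≡⟨ regroup (seq z i) (seq x i) (seq y i) ε ⟩
    seq z i ℚ.+ (seq y i ℚ.- seq x i) ℚ.+ ε          ≡⟨ cong (λ d → seq z i ℚ.+ d ℚ.+ ε) (same i) ⟩
    seq z i ℚ.+ (seq w i ℚ.- seq z i) ℚ.+ ε          ≡⟨ cancel (seq z i) (seq w i) ε ⟩
    seq w i ℚ.+ ε                                    ∎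
  where
  open ℚ.≤-Reasoning
  open +-*-Solver
  insert : ∀ c a → c ≡ c ℚ.- a ℚ.+ a
  insert = solve 2 (λ c a → c := c :- a :+ a) refl
  regroup : ∀ c a b e → c ℚ.- a ℚ.+ (b ℚ.+ e) ≡ c ℚ.+ (b ℚ.- a) ℚ.+ e
  regroup = solve 4 (λ c a b e → c :- a :+ (b :+ e) := c :+ (b :- a) :+ e) refl
  cancel : ∀ c d e → c ℚ.+ (d ℚ.- c) ℚ.+ e ≡ d ℚ.+ e
  cancel = solve 3 (λ c d e → c :+ (d :- c) :+ e := d :+ e) refl

module _ where
  open +-*-Solver

  +ℝ-monoˡ-≤ : ∀ z x y → x ≤ℝ y → x +ℝ z ≤ℝ y +ℝ z
  +ℝ-monoˡ-≤ z x y = ≤ℝ-resp-difference x y (x +ℝ z) (y +ℝ z) λ i →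
    solve 3 (λ a b c → b :- a := (b :+ c) :- (a :+ c)) refl (seq x i) (seq y i) (seq z i)

  +ℝ-monoʳ-≤ : ∀ z x y → x ≤ℝ y → z +ℝ x ≤ℝ z +ℝ y
  +ℝ-monoʳ-≤ z x y = ≤ℝ-resp-difference x y (z +ℝ x) (z +ℝ y) λ i →
    solve 3 (λ a b c → b :- a := (c :+ b) :- (c :+ a)) refl (seq x i) (seq y i) (seq z i)

  +ℝ-cancelʳ-≤ : ∀ z x y → x +ℝ z ≤ℝ y +ℝ z → x ≤ℝ y
  +ℝ-cancelʳ-≤ z x y = ≤ℝ-resp-difference (x +ℝ z) (y +ℝ z) x y λ i →
    solve 3 (λ a b c → (b :+ c) :- (a :+ c) := b :- a) refl (seq x i) (seq y i) (seq z i)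

  +ℝ-comm-≤ : ∀ x y → x +ℝ y ≤ℝ y +ℝ x
  +ℝ-comm-≤ x y = ≗⇒≤ℝ (x +ℝ y) (y +ℝ x) λ i → ℚ.+-comm (seq x i) (seq y i)

  +ℝ-right-comm-≤ : ∀ x y z → x +ℝ y +ℝ z ≤ℝ x +ℝ z +ℝ y
  +ℝ-right-comm-≤ x y z = ≗⇒≤ℝ (x +ℝ y +ℝ z) (x +ℝ z +ℝ y) λ i →
    solve 3 (λ a b c → a :+ b :+ c := a :+ c :+ b) refl (seq x i) (seq y i) (seq z i)

  -ℝ-≤⇒+ℝ-≤ : ∀ x y z w → x -ℝ y ≤ℝ z -ℝ w → x +ℝ w ≤ℝ z +ℝ y
  -ℝ-≤⇒+ℝ-≤ x y z w = ≤ℝ-resp-difference (x -ℝ y) (z -ℝ w) (x +ℝ w) (z +ℝ y) λ i →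
    -- `-ℝ` unfolds to scaling by `- 1ℚ`, so the solver needs that constant instead of its own
    -- subtraction.
    solve 4 (λ a b c d →
        (c :+ con (ℚ.- 1ℚ) :* d) :- (a :+ con (ℚ.- 1ℚ) :* b) := (c :+ b) :- (a :+ d))
      refl (seq x i) (seq y i) (seq z i) (seq w i)

  0ℝ≤⇒≤+ℝ : ∀ x y → 0ℝ ≤ℝ y → x ≤ℝ y +ℝ x
  0ℝ≤⇒≤+ℝ x y = ≤ℝ-resp-difference 0ℝ y x (y +ℝ x) λ i →
    solve 2 (λ a b → b :- con 0ℚ := (b :+ a) :- a) refl (seq x i) (seq y i)

+ℝ-mono-≤ : ∀ x y z w → x ≤ℝ y → z ≤ℝ w → x +ℝ z ≤ℝ y +ℝ w
+ℝ-mono-≤ x y z w x≤y z≤w =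
  ≤ℝ-trans {x +ℝ z} {y +ℝ z} {y +ℝ w} (+ℝ-monoˡ-≤ z x y x≤y) (+ℝ-monoʳ-≤ y z w z≤w)

·ℝ-monoʳ-≤-pos : ∀ q .{{_ : Positive q}} x y → x ≤ℝ y → q ·ℝ x ≤ℝ q ·ℝ y
·ℝ-monoʳ-≤-pos q x y x≤y ε 0<ε = bound (x≤y δ (ℚ.positive⁻¹ δ))
  where
  open ℚ.≤-Reasoning
  instance
    q≢0 : ℚ.NonZero q
    q≢0 = ℚ.pos⇒nonZero q
    q≥0 : ℚ.NonNegative q
    q≥0 = ℚ.pos⇒nonNeg q
    1/q⁺ : Positive (ℚ.1/ q)
    1/q⁺ = ℚ.1/pos⇒pos q
    ε⁺ : Positive ε
    ε⁺ = positive 0<ε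
  -- The tolerance is divided by `q` beforehand, so that scaling by `q` restores exactly `ε`.
  δ : ℚ
  δ = ℚ.1/ q ℚ.* ε
  instance
    δ⁺ : Positive δ
    δ⁺ = ℚ.pos*pos⇒pos (ℚ.1/ q) ε
  qδ≡ε : q ℚ.* δ ≡ ε
  qδ≡ε = trans (sym (ℚ.*-assoc q (ℚ.1/ q) ε))
    (trans (cong (ℚ._* ε) (ℚ.*-inverseʳ q)) (ℚ.*-identityˡ ε))
  bound : ∃[ M ] (∀ i → M ℕ.≤ i → seq x i ℚ.≤ seq y i ℚ.+ δ) →
          ∃[ M ] (∀ i → M ℕ.≤ i → q ℚ.* seq x i ℚ.≤ q ℚ.* seq y i ℚ.+ ε)
  bound (M , p) = M , λ i M≤i → begin
    q ℚ.* seq x i              ≤⟨ ℚ.*-monoˡ-≤-nonNeg q (p i M≤i) ⟩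
    q ℚ.* (seq y i ℚ.+ δ)      ≡⟨ ℚ.*-distribˡ-+ q (seq y i) δ ⟩
    q ℚ.* seq y i ℚ.+ q ℚ.* δ  ≡⟨ cong (q ℚ.* seq y i ℚ.+_) qδ≡ε ⟩
    q ℚ.* seq y i ℚ.+ ε        ∎

∑ℝ-mono-≤ : ∀ {k} (u v : Fin k → ℝ) → (∀ i → u i ≤ℝ v i) → ∑ℝ u ≤ℝ ∑ℝ v
∑ℝ-mono-≤ {zero}  u v u≤v = ≤ℝ-refl {0ℝ}
∑ℝ-mono-≤ {suc k} u v u≤v =
  +ℝ-mono-≤ (u zero) (v zero) (∑ℝ (u ∘ suc)) (∑ℝ (v ∘ suc)) (u≤v zero)
    (∑ℝ-mono-≤ (u ∘ suc) (v ∘ suc) (u≤v ∘ suc))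

-- Natural multiples

-- As a constant sum, this is a ready-made upper bound for `∑ℝ-mono-≤`, and `suc k ×ℝ x` unfolds to
-- `x +ℝ k ×ℝ x`.
infixr 7 _×ℝ_
_×ℝ_ : ℕ → ℝ → ℝ
k ×ℝ x = ∑ℝ {k} (λ _ → x)

-- `ℚ._/_` cancels a gcd and is stuck on variables; among unnormalised rationals the denominators
-- stay 1 and the claim is integer arithmetic.
fromℕ-+ : ∀ a b → + (a ℕ.+ b) ℚ./ 1 ≡ (+ a ℚ./ 1) ℚ.+ (+ b ℚ./ 1)
fromℕ-+ a b = ℚ.toℚᵘ-injective (begin
  ℚ.toℚᵘ (+ (a ℕ.+ b) ℚ./ 1)                       ≈⟨ ℚ.toℚᵘ-fromℚᵘ (mkℚᵘ (+ (a ℕ.+ b)) 0) ⟩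
  mkℚᵘ (+ (a ℕ.+ b)) 0                             ≈⟨ *≡* (cong (ℤ._* + 1)
                                                       (sym (cong₂ ℤ._+_ (ℤ.*-identityʳ (+ a)) (ℤ.*-identityʳ (+ b))))) ⟩
  mkℚᵘ (+ a) 0 ℚᵘ.+ mkℚᵘ (+ b) 0                   ≈⟨ ℚᵘ.+-cong (ℚ.toℚᵘ-fromℚᵘ (mkℚᵘ (+ a) 0)) (ℚ.toℚᵘ-fromℚᵘ (mkℚᵘ (+ b) 0)) ⟨
  ℚ.toℚᵘ (+ a ℚ./ 1) ℚᵘ.+ ℚ.toℚᵘ (+ b ℚ./ 1)       ≈⟨ ℚ.toℚᵘ-homo-+ (+ a ℚ./ 1) (+ b ℚ./ 1) ⟨
  ℚ.toℚᵘ ((+ a ℚ./ 1) ℚ.+ (+ b ℚ./ 1))             ∎)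
  where open ℚᵘ.≃-Reasoning

reciprocal-* : ∀ d .{{_ : NonZero d}} → (+ 1 ℚ./ d) ℚ.* (+ d ℚ./ 1) ≡ 1ℚ
reciprocal-* (suc d) = ℚ.toℚᵘ-injective (begin
  ℚ.toℚᵘ ((+ 1 ℚ./ suc d) ℚ.* (+ suc d ℚ./ 1))            ≈⟨ ℚ.toℚᵘ-homo-* (+ 1 ℚ./ suc d) (+ suc d ℚ./ 1) ⟩
  ℚ.toℚᵘ (+ 1 ℚ./ suc d) ℚᵘ.* ℚ.toℚᵘ (+ suc d ℚ./ 1)      ≈⟨ ℚᵘ.*-cong (ℚ.toℚᵘ-fromℚᵘ (mkℚᵘ (+ 1) d)) (ℚ.toℚᵘ-fromℚᵘ (mkℚᵘ (+ suc d) 0)) ⟩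
  mkℚᵘ (+ 1) d ℚᵘ.* mkℚᵘ (+ suc d) 0                      ≈⟨ ℚᵘ.*-inverseˡ (mkℚᵘ (+ suc d) 0) ⟩
  ℚ.toℚᵘ 1ℚ                                               ∎)
  where open ℚᵘ.≃-Reasoning

seq-×ℝ : ∀ k x i → seq (k ×ℝ x) i ≡ (+ k ℚ./ 1) ℚ.* seq x i
seq-×ℝ zero    x i = sym (ℚ.*-zeroˡ (seq x i))
seq-×ℝ (suc k) x i = begin
  seq x i ℚ.+ seq (k ×ℝ x) i                         ≡⟨ cong₂ ℚ._+_ (sym (ℚ.*-identityˡ (seq x i))) (seq-×ℝ k x i) ⟩
  1ℚ ℚ.* seq x i ℚ.+ (+ k ℚ./ 1) ℚ.* seq x i         ≡⟨ ℚ.*-distribʳ-+ (seq x i) 1ℚ (+ k ℚ./ 1) ⟨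
  (1ℚ ℚ.+ (+ k ℚ./ 1)) ℚ.* seq x i                   ≡⟨ cong (ℚ._* seq x i) (fromℕ-+ 1 k) ⟨
  (+ suc k ℚ./ 1) ℚ.* seq x i                        ∎
  where open ≡-Reasoning

-- The two multiples add up because (κ + 1) + (κ - 1) = 2κ, where κ - 1 is a true predecessor since
-- κ is nonzero.
×ℝ-average : ∀ κ .{{_ : NonZero κ}} x → 1/[2* κ ] ·ℝ (suc κ ×ℝ x +ℝ pred κ ×ℝ x) ≤ℝ x
×ℝ-average κ x = ≗⇒≤ℝ (1/[2* κ ] ·ℝ (suc κ ×ℝ x +ℝ pred κ ×ℝ x)) x λ i → begin
  q ℚ.* (seq (suc κ ×ℝ x) i ℚ.+ seq (pred κ ×ℝ x) i)
    ≡⟨ cong (q ℚ.*_) (cong₂ ℚ._+_ (seq-×ℝ (suc κ) x i) (seq-×ℝ (pred κ) x i)) ⟩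
  q ℚ.* ((+ suc κ ℚ./ 1) ℚ.* seq x i ℚ.+ (+ pred κ ℚ./ 1) ℚ.* seq x i)
    ≡⟨ cong (q ℚ.*_) (ℚ.*-distribʳ-+ (seq x i) (+ suc κ ℚ./ 1) (+ pred κ ℚ./ 1)) ⟨
  q ℚ.* (((+ suc κ ℚ./ 1) ℚ.+ (+ pred κ ℚ./ 1)) ℚ.* seq x i)
    ≡⟨ cong (λ c → q ℚ.* (c ℚ.* seq x i)) (fromℕ-+ (suc κ) (pred κ)) ⟨
  q ℚ.* ((+ (suc κ ℕ.+ pred κ) ℚ./ 1) ℚ.* seq x i)
    ≡⟨ cong (λ k → q ℚ.* ((+ k ℚ./ 1) ℚ.* seq x i)) total ⟩
  q ℚ.* ((+ (2 ℕ.* κ) ℚ./ 1) ℚ.* seq x i)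
    ≡⟨ ℚ.*-assoc q (+ (2 ℕ.* κ) ℚ./ 1) (seq x i) ⟨
  q ℚ.* (+ (2 ℕ.* κ) ℚ./ 1) ℚ.* seq x i
    ≡⟨ cong (ℚ._* seq x i) (reciprocal-* (2 ℕ.* κ) {{ℕ.m*n≢0 2 κ}}) ⟩
  1ℚ ℚ.* seq x i
    ≡⟨ ℚ.*-identityˡ (seq x i) ⟩
  seq x i ∎
  where
  open ≡-Reasoning
  q : ℚ
  q = 1/[2* κ ]
  total : suc κ ℕ.+ pred κ ≡ 2 ℕ.* κ
  total = trans (sym (ℕ.+-suc κ (pred κ)))
    (cong (κ ℕ.+_) (trans (ℕ.suc-pred κ) (sym (ℕ.+-identityʳ κ))))

1/[2*]-positive : ∀ κ .{{_ : NonZero κ}} → Positive 1/[2* κ ]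
1/[2*]-positive κ = ℚ.normalize-pos 1 (2 ℕ.* κ) {{ℕ.m*n≢0 2 κ}}

-- Finite subsets

∈-⋃⁺ : ∀ {N z} {S : Subset N} {Ss : List (Subset N)} → S ∈ˡ Ss → z ∈ S → z ∈ ⋃ Ss
∈-⋃⁺ {Ss = S ∷ Ss} (here refl) z∈S = p⊆p∪q (⋃ Ss) z∈S
∈-⋃⁺ {Ss = S ∷ Ss} (there S∈)  z∈S = q⊆p∪q S (⋃ Ss) (∈-⋃⁺ S∈ z∈S)

∈-⋃⁻ : ∀ {N z} (Ss : List (Subset N)) → z ∈ ⋃ Ss → ∃[ S ] (S ∈ˡ Ss × z ∈ S)
∈-⋃⁻ []       z∈ = ⊥-elim (∉⊥ z∈)
∈-⋃⁻ (S ∷ Ss) z∈ with x∈p∪q⁻ S (⋃ Ss) z∈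
... | inj₁ z∈S = S , here refl , z∈S
... | inj₂ z∈⋃ with T , T∈ , z∈T ← ∈-⋃⁻ Ss z∈⋃ = T , there T∈ , z∈T

∪-lub : ∀ {N} {A B S : Subset N} → A ⊆ S → B ⊆ S → A ∪ B ⊆ S
∪-lub {A = A} {B} A⊆S B⊆S = [ A⊆S , B⊆S ]′ ∘ x∈p∪q⁻ A B

⁅⁆-⊆ : ∀ {N} {y : Fin N} {S} → y ∈ S → ⁅ y ⁆ ⊆ S
⁅⁆-⊆ {y = y} {S} y∈S z∈ = subst (_∈ S) (sym (x∈⁅y⁆⇒x≡y y z∈)) y∈S

module _ {N n : ℕ} (y : Fin n → Fin N) where

  ∈-choices : ∀ l → y l ∈ choices y
  ∈-choices l = ∈-⋃⁺ (∈-tabulate⁺ l) (x∈⁅x⁆ (y l))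

  choices-⊆ : ∀ {S} → (∀ l → y l ∈ S) → choices y ⊆ S
  choices-⊆ y∈S z∈ with T , T∈ , z∈T ← ∈-⋃⁻ _ z∈
    with l , refl ← ∈-tabulate⁻ {f = ⁅_⁆ ∘ y} T∈ = ⁅⁆-⊆ (y∈S l) z∈T

  module _ {p} {P : Pred (Fin n) p} (P? : Decidable P) where

    ∈-choicesOf : ∀ l → P l → y l ∈ choicesOf y P?
    ∈-choicesOf l Pl =
      ∈-⋃⁺ (∈-map⁺ (⁅_⁆ ∘ y) (∈-filter⁺ P? (∈-allFin l) Pl)) (x∈⁅x⁆ (y l))

    choicesOf-⊆ : ∀ {S} → (∀ l → P l → y l ∈ S) → choicesOf y P? ⊆ S
    choicesOf-⊆ y∈S z∈ with T , T∈ , z∈T ← ∈-⋃⁻ _ z∈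
      with l , l∈ , refl ← ∈-map⁻ (⁅_⁆ ∘ y) T∈ =
      ⁅⁆-⊆ (y∈S l (proj₂ (∈-filter⁻ P? {xs = allFin n} l∈))) z∈T

-- Marginal rewards of monotone submodular functions

module _ {N : ℕ} (f : SetFunction N) (mono : Monotone f) (submod : Submodular f) where

  -- For `y` outside `B` this is submodularity with the negative terms moved across. For `y` in `B`
  -- the larger set gains nothing, while monotonicity makes the gain of `A` nonnegative.
  marginal-antitone : ∀ {A B} y → A ⊆ B → f (B ∪ ⁅ y ⁆) +ℝ f A ≤ℝ f (A ∪ ⁅ y ⁆) +ℝ f B
  marginal-antitone {A} {B} y A⊆B with y ∈? B
  ... | no y∉B =
    -ℝ-≤⇒+ℝ-≤ (f (B ∪ ⁅ y ⁆)) (f B) (f (A ∪ ⁅ y ⁆)) (f A) (submod A B y A⊆B y∉B)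
  ... | yes y∈B = begin
    f (B ∪ ⁅ y ⁆) +ℝ f A  ∼⟨ +ℝ-mono-≤ (f (B ∪ ⁅ y ⁆)) (f B) (f A) (f (A ∪ ⁅ y ⁆))
                               (mono (B ∪ ⁅ y ⁆) B (∪-lub ⊆-refl (⁅⁆-⊆ y∈B)))
                               (mono A (A ∪ ⁅ y ⁆) (p⊆p∪q ⁅ y ⁆)) ⟩
    f B +ℝ f (A ∪ ⁅ y ⁆)  ∼⟨ +ℝ-comm-≤ (f B) (f (A ∪ ⁅ y ⁆)) ⟩
    f (A ∪ ⁅ y ⁆) +ℝ f B  ∎
    where open ≤ℝ-Reasoning

-- Both marginal rewards subtract the same `f A`, which cancels.
argmax-Δ : ∀ {N} (f : SetFunction N) A {S} {x y} →
  IsArgmax (λ z → Δ f z A) S x → y ∈ S → f (A ∪ ⁅ y ⁆) ≤ℝ f (A ∪ ⁅ x ⁆)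
argmax-Δ f A {x = x} {y} (_ , best) y∈S =
  +ℝ-cancelʳ-≤ (f A) (f (A ∪ ⁅ y ⁆)) (f (A ∪ ⁅ x ⁆))
    (-ℝ-≤⇒+ℝ-≤ (f (A ∪ ⁅ y ⁆)) (f A) (f (A ∪ ⁅ x ⁆)) (f A) (best y y∈S))

-- Bounds on the optimum by the value of the greedy choices

module GreedyBounds
  {N n κ : ℕ} {X : Fin n → Subset N} (f : SetFunction N)
  (nonneg : NonNegative f) (mono : Monotone f) (submod : Submodular f)
  (x* : Fin n → Fin N) (feasible : Feasible X x*)
  (C : Cliques n κ) (x : Fin n → Fin N) (greedy : Cliques.IsGreedy C f X x)
  where
  open Cliques C
  open ≤ℝ-Reasoning

  greedyValue : ℝ
  greedyValue = f (choices x)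

  -- By definition, observed x i j is observedUpTo i (agentNo j).
  observedUpTo : ℕ → ℕ → Subset N
  observedUpTo i t = choicesOf x (λ l → (m i ℕ.≤? agentNo l) ×-dec (agentNo l ℕ.<? t))

  -- All greedy choices are included from the start, so every observed set lies inside every member
  -- of this chain, as `marginal-antitone` requires.
  withOptimal : ℕ → Subset N
  withOptimal t = choices x ∪ choicesOf x* (λ l → agentNo l ℕ.≤? t)

  observedUpTo⊆choices : ∀ i t → observedUpTo i t ⊆ choices x
  observedUpTo⊆choices i t = choicesOf-⊆ x _ (λ l _ → ∈-choices x l)

  observedUpTo-step : ∀ i j → m i ℕ.≤ agentNo j →
    observedUpTo i (agentNo j) ∪ ⁅ x j ⁆ ⊆ observedUpTo i (suc (agentNo j))
  observedUpTo-step i j mi≤j = ∪-lub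
    (choicesOf-⊆ x _ λ l (mi≤l , l<j) → ∈-choicesOf x _ l (mi≤l , ℕ.m<n⇒m<1+n l<j))
    (⁅⁆-⊆ (∈-choicesOf x _ j (mi≤j , ℕ.≤-refl)))

  -- Since `agentNo j` is `suc (toℕ j)`, raising the threshold from `toℕ j` admits only agent `j`.
  withOptimal-step : ∀ j → withOptimal (agentNo j) ⊆ withOptimal (toℕ j) ∪ ⁅ x* j ⁆
  withOptimal-step j = ∪-lub
    (⊆-trans (p⊆p∪q _) (p⊆p∪q ⁅ x* j ⁆))
    (choicesOf-⊆ x* _ λ l l≤j → add l (ℕ.m≤n⇒m<n∨m≡n l≤j))
    where
    add : ∀ l → agentNo l ℕ.< agentNo j ⊎ agentNo l ≡ agentNo j →
          x* l ∈ withOptimal (toℕ j) ∪ ⁅ x* j ⁆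
    add l (inj₁ l<j) = p⊆p∪q ⁅ x* j ⁆ (q⊆p∪q (choices x) _ (∈-choicesOf x* _ l (ℕ.s≤s⁻¹ l<j)))
    add l (inj₂ l≡j) rewrite toℕ-injective (ℕ.suc-injective l≡j) =
      q⊆p∪q (withOptimal (toℕ j)) ⁅ x* j ⁆ (x∈⁅x⁆ (x* j))

  -- One term of the telescoping sum, free of subtraction: adding `x* j` to the chain gains no more
  -- than adding `x j` to what `j` observes.
  agent-step : ∀ i j → i ℕ.< κ → InClique i j →
    f (withOptimal (agentNo j)) +ℝ f (observedUpTo i (agentNo j))
      ≤ℝ f (observedUpTo i (suc (agentNo j))) +ℝ f (withOptimal (toℕ j))
  agent-step i j i<κ j∈i = begin
    f (withOptimal (agentNo j)) +ℝ f E  ∼⟨ +ℝ-monoˡ-≤ (f E) (f (withOptimal (agentNo j))) (f (Q ∪ ⁅ x* j ⁆))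
                                             (mono (withOptimal (agentNo j)) (Q ∪ ⁅ x* j ⁆) (withOptimal-step j)) ⟩
    f (Q ∪ ⁅ x* j ⁆) +ℝ f E             ∼⟨ marginal-antitone f mono submod (x* j)
                                             (⊆-trans (observedUpTo⊆choices i (agentNo j)) (p⊆p∪q _)) ⟩
    f (E ∪ ⁅ x* j ⁆) +ℝ f Q             ∼⟨ +ℝ-monoˡ-≤ (f Q) (f (E ∪ ⁅ x* j ⁆)) (f (E ∪ ⁅ x j ⁆))
                                             (argmax-Δ f E (greedy i j i<κ j∈i) (feasible j)) ⟩
    f (E ∪ ⁅ x j ⁆) +ℝ f Q              ∼⟨ +ℝ-monoˡ-≤ (f Q) (f (E ∪ ⁅ x j ⁆)) (f E′)
                                             (mono (E ∪ ⁅ x j ⁆) E′ (observedUpTo-step i j (ℕ.<⇒≤ (proj₁ j∈i)))) ⟩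
    f E′ +ℝ f Q                         ∎
    where
    E E′ Q : Subset N
    E  = observedUpTo i (agentNo j)
    E′ = observedUpTo i (suc (agentNo j))
    Q  = withOptimal (toℕ j)

  -- Agents are replaced by bare numbers, so that the next induction can run over `t`; the agent
  -- involved has index `t` and number `suc t`.
  number-step : ∀ i t → i ℕ.< κ → m i ℕ.≤ t → t ℕ.< m (suc i) →
    f (withOptimal (suc t)) +ℝ f (observedUpTo i (suc t))
      ≤ℝ f (observedUpTo i (suc (suc t))) +ℝ f (withOptimal t)
  number-step i t i<κ mi≤t t<m = subst
    (λ t → f (withOptimal (suc t)) +ℝ f (observedUpTo i (suc t))
             ≤ℝ f (observedUpTo i (suc (suc t))) +ℝ f (withOptimal t))
    j≡t
    (agent-step i (fromℕ< t<n) i<κ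
      (subst (λ t → m i ℕ.< suc t × suc t ℕ.≤ m (suc i)) (sym j≡t) (ℕ.s≤s mi≤t , t<m)))
    where
    t<n : t ℕ.< n
    t<n = ℕ.<-≤-trans t<m (m≤n (suc i) i<κ)
    j≡t : toℕ (fromℕ< t<n) ≡ t
    j≡t = toℕ-fromℕ< t<n

  -- Telescoping along one clique, with `c` carrying the bound from the earlier cliques. The form
  -- `≤′` lets the induction climb from `m i`.
  within-clique : ∀ i → i ℕ.< κ → ∀ c → f (withOptimal (m i)) ≤ℝ c →
    ∀ {t} → m i ≤′ t → t ℕ.≤ m (suc i) → f (withOptimal t) ≤ℝ f (observedUpTo i (suc t)) +ℝ c
  -- Here `E` holds at most the choice of agent `m i`. Its value is where the telescoping starts,
  -- and nonnegativity allows it to be kept on the right.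
  within-clique i i<κ c base (≤′-reflexive refl) _ =
    ≤ℝ-trans {f (withOptimal (m i))} {c} {f E +ℝ c} base (0ℝ≤⇒≤+ℝ c (f E) (nonneg E))
    where
    E : Subset N
    E = observedUpTo i (suc (m i))
  within-clique i i<κ c base {suc t} (≤′-step mi≤′t) t<m =
    -- `f E` is the intermediate term: the new step has it on the left and the induction hypothesis
    -- on the right.
    +ℝ-cancelʳ-≤ (f E) (f Q′) (f E′ +ℝ c) (begin
      f Q′ +ℝ f E           ∼⟨ number-step i t i<κ (ℕ.≤′⇒≤ mi≤′t) t<m ⟩
      f E′ +ℝ f Q           ∼⟨ +ℝ-monoʳ-≤ (f E′) (f Q) (f E +ℝ c)
                                 (within-clique i i<κ c base mi≤′t (ℕ.<⇒≤ t<m)) ⟩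
      f E′ +ℝ (f E +ℝ c)    ∼⟨ ≗⇒≤ℝ (f E′ +ℝ (f E +ℝ c)) (f E′ +ℝ f E +ℝ c)
                                 (λ k → sym (ℚ.+-assoc (seq (f E′) k) (seq (f E) k) (seq c k))) ⟩
      f E′ +ℝ f E +ℝ c      ∼⟨ +ℝ-right-comm-≤ (f E′) (f E) c ⟩
      f E′ +ℝ c +ℝ f E      ∎)
    where
    E E′ Q Q′ : Subset N
    E  = observedUpTo i (suc t)
    E′ = observedUpTo i (suc (suc t))
    Q  = withOptimal t
    Q′ = withOptimal (suc t)

  -- One copy of `greedyValue` pays for the initial set `choices x`, and each completed clique costs
  -- one more.
  cliques-bound : ∀ i → i ℕ.≤ κ → f (withOptimal (m i)) ≤ℝ suc i ×ℝ greedyValue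
  cliques-bound zero _ = begin
    -- Agent numbers start at 1, so no optimal choice has been added at threshold `m 0`, which is 0.
    f (withOptimal (m 0))   ∼⟨ mono (withOptimal (m 0)) (choices x) (∪-lub ⊆-refl
                                 (choicesOf-⊆ x* _ λ l l≤m₀ →
                                   ⊥-elim (ℕ.n≮0 (subst (agentNo l ℕ.≤_) m-first l≤m₀)))) ⟩
    greedyValue             ∼⟨ ≗⇒≤ℝ greedyValue (1 ×ℝ greedyValue)
                                 (λ k → sym (ℚ.+-identityʳ (seq greedyValue k))) ⟩
    1 ×ℝ greedyValue        ∎
  cliques-bound (suc i) i<κ = begin
    f (withOptimal (m (suc i)))   ∼⟨ within-clique i i<κ c (cliques-bound i (ℕ.<⇒≤ i<κ))
                                       (ℕ.≤⇒≤′ (ℕ.<⇒≤ (m-mono i i<κ))) ℕ.≤-refl ⟩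
    f E +ℝ c                      ∼⟨ +ℝ-monoˡ-≤ c (f E) greedyValue
                                       (mono E (choices x) (observedUpTo⊆choices i (suc (m (suc i))))) ⟩
    greedyValue +ℝ c              ∎
    where
    c : ℝ
    c = suc i ×ℝ greedyValue
    E : Subset N
    E = observedUpTo i (suc (m (suc i)))

  optimum-bound : f (choices x*) ≤ℝ suc κ ×ℝ greedyValue
  optimum-bound = begin
    f (choices x*)           ∼⟨ mono (choices x*) (withOptimal (m κ)) (choices-⊆ x* λ l →
                                  q⊆p∪q (choices x) _ (∈-choicesOf x* _ l
                                    (subst (agentNo l ℕ.≤_) (sym m-last) (toℕ<n l)))) ⟩
    f (withOptimal (m κ))    ∼⟨ cliques-bound κ ℕ.≤-refl ⟩
    suc κ ×ℝ greedyValue     ∎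

  singleton-bound : ∀ i j → i ℕ.< κ → InClique i j → f ⁅ x* j ⁆ ≤ℝ greedyValue
  singleton-bound i j i<κ j∈i = begin
    f ⁅ x* j ⁆          ∼⟨ mono ⁅ x* j ⁆ (E ∪ ⁅ x* j ⁆) (q⊆p∪q E ⁅ x* j ⁆) ⟩
    f (E ∪ ⁅ x* j ⁆)    ∼⟨ argmax-Δ f E (greedy i j i<κ j∈i) (feasible j) ⟩
    f (E ∪ ⁅ x j ⁆)     ∼⟨ mono (E ∪ ⁅ x j ⁆) (choices x)
                             (∪-lub (observedUpTo⊆choices i (agentNo j)) (⁅⁆-⊆ (∈-choices x j))) ⟩
    greedyValue         ∎
    where
    E : Subset N
    E = observedUpTo i (agentNo j)

  boundary-bound : ∀ b → f ⁅ x* (boundary b) ⁆ ≤ℝ greedyValue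
  -- The boundary agent indexed by `b` is the last member of the clique that starts after
  -- `m (toℕ b)`, hence the reflexive upper bound.
  boundary-bound b = singleton-bound (toℕ b) (boundary b) b<κ
    (subst (m (toℕ b) ℕ.<_) (sym (agentNo-boundary b)) (m-mono (toℕ b) b<κ) ,
     ℕ.≤-reflexive (agentNo-boundary b))
    where
    b<κ : toℕ b ℕ.< κ
    b<κ = ℕ.<⇒≤ (suc-i<κ b)

mainTheorem3 : ∀ (N n κ : ℕ) .{{_ : NonZero κ}}
    (X : Fin n → Subset N) → IsPartition X →
    ∀ (f : SetFunction N) →
    NonNegative f → Normalized f → Monotone f → Submodular f →
    ∀ (x* : Fin n → Fin N) → IsOptimal f X x* →
    ∀ (C : Cliques n κ) (x : Fin n → Fin N) → Cliques.IsGreedy C f X x →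
    1/[2* κ ] ·ℝ (f (choices x*) +ℝ ∑ℝ (λ i → f ⁅ x* (Cliques.boundary C i) ⁆))
    ≤ℝ f (choices x)
mainTheorem3 N n κ X _ f nonneg _ mono submod x* (feasible , _) C x greedy = begin
  1/[2* κ ] ·ℝ (f (choices x*) +ℝ ∑ℝ singletons)
    ∼⟨ ·ℝ-monoʳ-≤-pos 1/[2* κ ] {{1/[2*]-positive κ}}
         (f (choices x*) +ℝ ∑ℝ singletons) (suc κ ×ℝ v +ℝ pred κ ×ℝ v)
         (+ℝ-mono-≤ (f (choices x*)) (suc κ ×ℝ v) (∑ℝ singletons) (pred κ ×ℝ v)
           -- The sum of the constant `v` over `Fin (pred κ)` is `pred κ ×ℝ v` by definition.
           optimum-bound (∑ℝ-mono-≤ singletons (λ _ → v) boundary-bound)) ⟩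
  1/[2* κ ] ·ℝ (suc κ ×ℝ v +ℝ pred κ ×ℝ v)
    ∼⟨ ×ℝ-average κ v ⟩
  v ∎
  where
  open ≤ℝ-Reasoning
  open GreedyBounds {X = X} f nonneg mono submod x* feasible C x greedy
    using (optimum-bound; boundary-bound)
  v : ℝ
  v = f (choices x)
  singletons : Fin (pred κ) → ℝ
  singletons i = f ⁅ x* (Cliques.boundary C i) ⁆
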